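{- Let $n\ge 5$ and let $P_n$ be the path on $n$ vertices. If $n$ is even then $\mathrm{ern}(P_n)=2$, while if $n$ is odd then $\mathrm{ern}(P_n)=3$.
   Context: All graphs are finite, simple and undirected. An edge-card of a graph $G$ is an edge-deleted subgraph $G-e$ (all vertices are kept), considered up to isomorphism. For distinct edges $e_1,\dots,e_k$ of $G$, the edge-cards $G-e_1,\dots,G-e_k$ are said to reconstruct $G$ if every graph $H$ having distinct edges $f_1,\dots,f_k$ with $H-f_i\simeq G-e_i$ for all $i$ is isomorphic to $G$ ($H$ ranges over all graphs, not only trees). The edge-reconstruction number $\mathrm{ern}(G)$ is the least $k$ for which some $k$ edge-cards of $G$ reconstruct $G$. -}

module Defs where

open import Data.Fin using (Fin; toℕ)
open import Data.Fin.Properties using () renaming (_≟_ to _≟ᶠ_)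
open import Data.Nat using (ℕ; suc; _≤_)
open import Data.Nat.Properties using (_≟_; 1+n≢n)
open import Data.Product using (_×_; _,_; Σ-syntax)
open import Data.Sum using (_⊎_; inj₁; inj₂; [_,_]) renaming (swap to ⊎-swap)
open import Function using (_∘_)
open import Function.Bundles using (_↔_; _⇔_; Inverse)
open import Function.Definitions using (Injective)
open import Level using (0ℓ)
open import Relation.Binary.Core using (Rel)
open import Relation.Binary.Definitions using (Decidable; Symmetric)
open import Relation.Binary.PropositionalEquality using (_≡_)
open import Relation.Nullary using (¬_; ¬?; _×-dec_; _⊎-dec_)

-- Every finite graph is taken, up to isomorphism, on a vertex set Fin order.
-- Decidability of adjacency is what makes the edge set finite constructively.
record Graph : Set₁ where
  field
    order  : ℕ
    Adj    : Rel (Fin order) 0ℓ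
    adj?   : Decidable Adj
    symm   : Symmetric Adj
    irrefl : ∀ {v} → ¬ Adj v v

  Vertex : Set
  Vertex = Fin order

open Graph public

infix 4 _≅_
record _≅_ (G H : Graph) : Set where
  field
    bij     : Vertex G ↔ Vertex H
    adj-iff : ∀ u v → Adj G u v ⇔ Adj H (Inverse.to bij u) (Inverse.to bij v)

SamePair : ∀ {n} → (u v x y : Fin n) → Set
SamePair u v x y = (u ≡ x × v ≡ y) ⊎ (u ≡ y × v ≡ x)

-- An edge is given by an ordered pair of adjacent ends; _≈ₑ_ identifies the
-- two orientations (and all adjacency proofs), so it is equality of edges.
record Edge (G : Graph) : Set where
  constructor edge
  field
    src tgt : Vertex G
    adj     : Adj G src tgt

open Edge public

infix 4 _≈ₑ_
_≈ₑ_ : ∀ {G} → Rel (Edge G) 0ℓ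
e ≈ₑ f = SamePair (src e) (tgt e) (src f) (tgt f)

infixl 6 _-ₑ_
_-ₑ_ : (G : Graph) → Edge G → Graph
G -ₑ e = record
  { order  = order G
  ; Adj    = λ u v → Adj G u v × ¬ SamePair u v (src e) (tgt e)
  ; adj?   = λ u v → adj? G u v ×-dec
               ¬? ((u ≟ᶠ src e ×-dec v ≟ᶠ tgt e) ⊎-dec (u ≟ᶠ tgt e ×-dec v ≟ᶠ src e))
  ; symm   = λ (a , ne) → symm G a , ne ∘ flipPair
  ; irrefl = λ (a , _) → irrefl G a
  }
  where
  flipPair : ∀ {n} {u v x y : Fin n} → SamePair v u x y → SamePair u v x y
  flipPair = ⊎-swap ∘ [ (λ (p , q) → inj₁ (q , p)) , (λ (p , q) → inj₂ (q , p)) ]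

Distinct : ∀ {G k} → (Fin k → Edge G) → Set
Distinct {G} = Injective _≡_ (_≈ₑ_ {G})

Reconstruct : (G : Graph) {k : ℕ} → (Fin k → Edge G) → Set₁
Reconstruct G {k} e =
  (H : Graph) (f : Fin k → Edge H) → Distinct {H} f →
  (∀ i → (H -ₑ f i) ≅ (G -ₑ e i)) → H ≅ G

ReconstructibleFrom : Graph → ℕ → Set₁
ReconstructibleFrom G k =
  Σ[ e ∈ (Fin k → Edge G) ] (Distinct {G} e × Reconstruct G e)

-- ern(G) = k as a relation: k is least such that some k edge-cards
-- reconstruct G.
IsErn : Graph → ℕ → Set₁
IsErn G k = ReconstructibleFrom G k × (∀ j → ReconstructibleFrom G j → k ≤ j)

P : ℕ → Graph
P n = record
  { order  = n
  ; Adj    = λ i j → suc (toℕ i) ≡ toℕ j ⊎ suc (toℕ j) ≡ toℕ i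
  ; adj?   = λ i j → (suc (toℕ i) ≟ toℕ j) ⊎-dec (suc (toℕ j) ≟ toℕ i)
  ; symm   = ⊎-swap
  ; irrefl = [ 1+n≢n , 1+n≢n ]
  }

module Submission where

-- Let the cards P n - e and P n - f have parts of sizes a, b and a', b', where a' and b' exceed
-- neither a nor b by more than one. If the first deleted edge of a graph H with these cards joins
-- the two parts, then it joins ends of them, so H is a path: an end interior to its part would
-- have degree 3 in H, hence lie on the second deleted edge, and this would cut off a component of
-- a wrong size. A card whose part sizes differ from a and b shows that the first deleted edge does
-- join the two parts. For n = 2m the cards with parts (m, m) and (m + 1, m - 1) do both jobs; for
-- odd n a third card is needed.
--
-- Conversely, cards with parts a, a' satisfying a + a' ≥ n + 2 are also cards of a spider with
-- three legs. One card always extends to such a pair. For odd n two cards, each represented by its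
-- larger part, fail to do so only if both have parts (n + 1)/2 and (n - 1)/2; these are cards of
-- the disjoint union of a path and a triangle with a (possibly empty) tail.

open import Defs
open import Data.Empty using (⊥; ⊥-elim)
open import Data.Fin using (Fin; zero; suc; toℕ; fromℕ<)
open import Data.Fin.Properties
  using (toℕ<n; toℕ-injective; toℕ-fromℕ<; injective⇒≤) renaming (_≟_ to _≟ᶠ_)
open import Data.Nat using (ℕ; zero; suc; _+_; _*_; _∸_; _≤_; _<_; s≤s; z≤n; _<?_; _≤?_)
open import Data.Nat.Divisibility using (_∣_; divides)
open import Data.Nat.Properties
open import Data.Product using (_×_; _,_; proj₁; proj₂; Σ-syntax; ∃-syntax)
open import Data.Sum using (_⊎_; inj₁; inj₂; [_,_]) renaming (swap to ⊎-swap; map to ⊎-map)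
open import Function using (_∘_; id)
open import Function.Bundles using (_↔_; _⇔_; mk⇔; mk↔ₛ′; module Inverse; module Equivalence)
open import Function.Properties.Inverse using (↔-sym; ↔-trans; ↔-refl)
open import Relation.Binary.PropositionalEquality
  using (_≡_; _≢_; refl; sym; trans; cong; subst; subst₂)
open import Relation.Nullary using (¬_; Dec; yes; no; _×-dec_; _⊎-dec_; ¬?; contradiction)

-- Isomorphisms and orientations of edges

open _≅_

to : ∀ {G H} → G ≅ H → Vertex G → Vertex H
to φ = Inverse.to (bij φ)

from : ∀ {G H} → G ≅ H → Vertex H → Vertex G
from φ = Inverse.from (bij φ)

to∘from : ∀ {G H} (φ : G ≅ H) v → to φ (from φ v) ≡ v
to∘from φ = Inverse.strictlyInverseˡ (bij φ)

from∘to : ∀ {G H} (φ : G ≅ H) v → from φ (to φ v) ≡ v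
from∘to φ = Inverse.strictlyInverseʳ (bij φ)

to-adj : ∀ {G H} (φ : G ≅ H) {u v} → Adj G u v → Adj H (to φ u) (to φ v)
to-adj φ {u} {v} = Equivalence.to (adj-iff φ u v)

from-adj : ∀ {G H} (φ : G ≅ H) {u v} → Adj H (to φ u) (to φ v) → Adj G u v
from-adj φ {u} {v} = Equivalence.from (adj-iff φ u v)

mk≅ : ∀ {G H} (π : Vertex G ↔ Vertex H) →
      (∀ {u v} → Adj G u v → Adj H (Inverse.to π u) (Inverse.to π v)) →
      (∀ {u v} → Adj H u v → Adj G (Inverse.from π u) (Inverse.from π v)) → G ≅ H
mk≅ {G} π there back = record
  { bij = π
  ; adj-iff = λ u v → mk⇔ there
      (λ e → subst₂ (Adj G) (Inverse.strictlyInverseʳ π u) (Inverse.strictlyInverseʳ π v) (back e))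
  }

≅-sym : ∀ {G H} → G ≅ H → H ≅ G
≅-sym {G} {H} φ = mk≅ (↔-sym (bij φ))
  (λ {u} {v} e → from-adj φ (subst₂ (Adj H) (sym (to∘from φ u)) (sym (to∘from φ v)) e))
  (to-adj φ)

≅-trans : ∀ {G H K} → G ≅ H → H ≅ K → G ≅ K
≅-trans φ ψ = record
  { bij = ↔-trans (bij φ) (bij ψ)
  ; adj-iff = λ u v → mk⇔ (to-adj ψ ∘ to-adj φ) (from-adj φ ∘ from-adj ψ)
  }

samePair? : ∀ {n} (u v x y : Fin n) → Dec (SamePair u v x y)
samePair? u v x y = (u ≟ᶠ x ×-dec v ≟ᶠ y) ⊎-dec (u ≟ᶠ y ×-dec v ≟ᶠ x)

samePair-swap : ∀ {n} {u v x y : Fin n} → SamePair u v x y → SamePair v u x y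
samePair-swap (inj₁ (p , q)) = inj₂ (q , p)
samePair-swap (inj₂ (p , q)) = inj₁ (q , p)

samePair-sym : ∀ {n} {u v x y : Fin n} → SamePair u v x y → SamePair x y u v
samePair-sym (inj₁ (refl , refl)) = inj₁ (refl , refl)
samePair-sym (inj₂ (refl , refl)) = inj₂ (refl , refl)

flip : ∀ {G} → Edge G → Edge G
flip {G} (edge x y a) = edge y x (symm G a)

flip-≅ : ∀ {G} (e : Edge G) → G -ₑ flip {G} e ≅ G -ₑ e
flip-≅ e = mk≅ ↔-refl (λ (a , ne) → a , ne ∘ ⊎-swap) (λ (a , ne) → a , ne ∘ ⊎-swap)

-- Unions of two paths with labelled vertices

Step : ℕ → ℕ → ℕ → Set
Step a i j = suc i ≡ j × j ≢ a

Near : ℕ → ℕ → ℕ → Set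
Near a i j = Step a i j ⊎ Step a j i

near? : ∀ a i j → Dec (Near a i j)
near? a i j = (suc i ≟ j ×-dec ¬? (j ≟ a)) ⊎-dec (suc j ≟ i ×-dec ¬? (i ≟ a))

near-irrefl : ∀ {a i} → ¬ Near a i i
near-irrefl = [ 1+n≢n ∘ proj₁ , 1+n≢n ∘ proj₁ ]

-- The graph P a ∪ P (n ∸ a): the path on 0, …, n - 1 without the edge {a - 1, a}.
-- For a = 0 and a = n nothing is removed.
Card : ℕ → ℕ → Graph
Card n a = record
  { order  = n
  ; Adj    = λ i j → Near a (toℕ i) (toℕ j)
  ; adj?   = λ i j → near? a (toℕ i) (toℕ j)
  ; symm   = ⊎-swap
  ; irrefl = near-irrefl
  }

label : ∀ {G n a} → G ≅ Card n a → Vertex G → ℕ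
label φ v = toℕ (to φ v)

label<n : ∀ {G n a} (φ : G ≅ Card n a) v → label φ v < n
label<n φ v = toℕ<n (to φ v)

label-injective : ∀ {G n a} (φ : G ≅ Card n a) {u v} → label φ u ≡ label φ v → u ≡ v
label-injective φ {u} {v} eq =
  trans (sym (from∘to φ u)) (trans (cong (from φ) (toℕ-injective eq)) (from∘to φ v))

label-surjective : ∀ {G n a} (φ : G ≅ Card n a) {i} → i < n → Σ[ v ∈ Vertex G ] label φ v ≡ i
label-surjective φ i<n =
  from φ (fromℕ< i<n) , trans (cong toℕ (to∘from φ (fromℕ< i<n))) (toℕ-fromℕ< i<n)

P≅Card₀ : ∀ n → P n ≅ Card n 0
P≅Card₀ n = mk≅ ↔-refl
  (⊎-map (λ eq → eq , λ z → 1+n≢0 (trans eq z)) (λ eq → eq , λ z → 1+n≢0 (trans eq z)))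
  (⊎-map proj₁ proj₁)

-- Reversals of labels

-- The reversal of the labels p, …, n - 1, described without subtraction.
data Reflection (n p i : ℕ) : ℕ → Set where
  fixed  : i < p → Reflection n p i i
  turned : ∀ {i'} → p ≤ i → p ≤ i' → suc (i' + i) ≡ n + p → Reflection n p i i'

reflect : ∀ {n} (p : ℕ) (i : Fin n) → Σ[ j ∈ Fin n ] Reflection n p (toℕ i) (toℕ j)
reflect {n} p i with toℕ i <? p
... | yes i<p = i , fixed i<p
... | no i≮p = fromℕ< j<n , subst (Reflection n p (toℕ i)) (sym (toℕ-fromℕ< j<n))
                              (turned p≤i p≤j eq)
  where
  p≤i = ≮⇒≥ i≮p
  j = n + p ∸ suc (toℕ i)
  sum≡ : j + suc (toℕ i) ≡ n + p
  sum≡ = m∸n+n≡m (≤-trans (toℕ<n i) (m≤m+n n p))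
  eq : suc (j + toℕ i) ≡ n + p
  eq = trans (sym (+-suc j (toℕ i))) sum≡
  j<n : j < n
  j<n = +-cancelʳ-< (suc (toℕ i)) j n
          (subst (_< n + suc (toℕ i)) (sym sum≡) (+-monoʳ-< n (s≤s p≤i)))
  p≤j : p ≤ j
  p≤j = +-cancelʳ-≤ n p j
          (≤-trans (≤-reflexive (trans (+-comm p n) (sym sum≡))) (+-monoʳ-≤ j (toℕ<n i)))

ρ : ∀ {n} → ℕ → Fin n → Fin n
ρ p i = proj₁ (reflect p i)

ρ-spec : ∀ {n} p (i : Fin n) → Reflection n p (toℕ i) (toℕ (ρ p i))
ρ-spec p i = proj₂ (reflect p i)

reflection-involutive : ∀ {n p i j k} → Reflection n p i j → Reflection n p j k → k ≡ i
reflection-involutive (fixed _) (fixed _) = refl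
reflection-involutive (fixed i<p) (turned p≤i _ _) = contradiction i<p (≤⇒≯ p≤i)
reflection-involutive (turned _ p≤j _) (fixed j<p) = contradiction j<p (≤⇒≯ p≤j)
reflection-involutive {i = i} {j} {k} (turned _ _ eq) (turned _ _ eq') =
  +-cancelʳ-≡ j k i (suc-injective (trans eq' (trans (sym eq) (cong suc (+-comm j i)))))

ρ-involutive : ∀ {n} p (i : Fin n) → ρ p (ρ p i) ≡ i
ρ-involutive p i = toℕ-injective (reflection-involutive (ρ-spec p i) (ρ-spec p (ρ p i)))

ρ-↔ : ∀ n → ℕ → Fin n ↔ Fin n
ρ-↔ n p = mk↔ₛ′ (ρ p) (ρ p) (ρ-involutive p) (ρ-involutive p)

-- Ensures that reversing the labels from `p` on sends no step of the card with gap `a` into the gap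
-- `a'`. Steps are named by their upper ends: below `p` these stay put, while the step from `i` to
-- `i + 1` turns into one whose upper end is `i'`, the image of `i`.
Compatible : (n p a a' : ℕ) → Set
Compatible n p a a' =
  (∀ {j} → j < p → j ≢ a → j ≢ a') ×
  (∀ {i i'} → suc i < n → suc (i' + i) ≡ n + p → suc i ≢ a → i' ≢ a')

-- A step into `p` would enter the reversed range from outside and is excluded. That the image does
-- not end in `p` either is recorded for `bridge-card`, where it keeps the image off the bridge.
reflection-step : ∀ {n p a a' i j i' j'} → Compatible n p a a' → j < n →
  Reflection n p i i' → Reflection n p j j' → Step a i j → j ≢ p →
  (Step a' i' j' × j' ≢ p) ⊎ (Step a' j' i' × i' ≢ p)
reflection-step (low , _) _ (fixed _) (fixed j<p) (eq , j≢a) j≢p = inj₁ ((eq , low j<p j≢a) , j≢p)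
reflection-step _ _ (fixed i<p) (turned p≤j _ _) (refl , _) j≢p =
  contradiction (≤-antisym i<p p≤j) j≢p
reflection-step _ _ (turned p≤i _ _) (fixed j<p) (refl , _) _ =
  contradiction (<-trans (n<1+n _) j<p) (≤⇒≯ p≤i)
reflection-step {i = i} {i' = i'} {j'} (_ , high) j<n (turned _ _ eq) (turned _ p≤j' eq') (refl , j≢a) _ =
  inj₂ ((sym i'≡ , high j<n eq j≢a) , λ i'≡p → <⇒≢ (s≤s p≤j') (trans (sym i'≡p) i'≡))
  where
  i'≡ : i' ≡ suc j'
  i'≡ = +-cancelʳ-≡ i i' (suc j') (suc-injective (trans eq (trans (sym eq') (cong suc (+-suc j' i)))))

-- The second hypothesis holds in two situations: for `p = 0`, as no step ends at 0, and for
-- `p = a`, as the step into `a` is the missing one.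
ρ-near : ∀ {n p a a'} → Compatible n p a a' →
  (∀ {i j} → Step a i j → j ≢ p) →
  ∀ {u v : Fin n} → Near a (toℕ u) (toℕ v) → Near a' (toℕ (ρ p u)) (toℕ (ρ p v))
ρ-near {p = p} c whole {u} {v} (inj₁ s) =
  ⊎-map proj₁ proj₁ (reflection-step c (toℕ<n v) (ρ-spec p u) (ρ-spec p v) s (whole s))
ρ-near {p = p} c whole {u} {v} (inj₂ s) =
  ⊎-swap (⊎-map proj₁ proj₁ (reflection-step c (toℕ<n u) (ρ-spec p v) (ρ-spec p u) s (whole s)))

-- The reversal sends `a - 1` to `n + p - a = a'`, so gap goes to gap; below `p` there is no gap to
-- meet, since `p ≤ a'`.
compatible-sum : ∀ {n p a a'} → p ≤ a' → a + a' ≡ n + p → Compatible n p a a'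
compatible-sum {n} {p} {a} {a'} p≤a' sum =
  (λ j<p _ → <⇒≢ (≤-trans j<p p≤a')) ,
  λ { {i} _ eq i≢a refl → i≢a (+-cancelʳ-≡ a' (suc i) a (trans (cong suc (+-comm i a')) (trans eq (sym sum)))) }

reverse-≅ : ∀ {n a b} → a + b ≡ n → Card n a ≅ Card n b
reverse-≅ {n} {a} {b} a+b≡n = mk≅ (ρ-↔ n 0)
  (λ {u} {v} → ρ-near (compatible-sum z≤n (trans a+b≡n (sym (+-identityʳ n)))) whole {u} {v})
  (λ {u} {v} → ρ-near (compatible-sum z≤n (trans (+-comm b a) (trans a+b≡n (sym (+-identityʳ n))))) whole {u} {v})
  where
  whole : ∀ {c i j} → Step c i j → j ≢ 0
  whole (refl , _) ()

reflection-high : ∀ {n p i j} → Reflection n p i j → p ≤ i → suc (j + i) ≡ n + p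
reflection-high (fixed i<p) p≤i = contradiction i<p (≤⇒≯ p≤i)
reflection-high (turned _ _ eq) _ = eq

reflection-≥ : ∀ {n p i j} → Reflection n p i j → p ≤ i → p ≤ j
reflection-≥ (fixed i<p) p≤i = contradiction i<p (≤⇒≯ p≤i)
reflection-≥ (turned _ p≤j _) _ = p≤j

reflection-low : ∀ {n p i j} → Reflection n p i j → i < p → j ≡ i
reflection-low (fixed _) _ = refl
reflection-low (turned p≤i _ _) i<p = contradiction i<p (≤⇒≯ p≤i)

reverse-label : ∀ {G n a b} (φ : G ≅ Card n a) (a+b≡n : a + b ≡ n) v →
  suc (label (≅-trans φ (reverse-≅ a+b≡n)) v + label φ v) ≡ n
reverse-label {n = n} φ a+b≡n v = trans (reflection-high (ρ-spec 0 (to φ v)) z≤n) (+-identityʳ n)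

reverseUpper-≅ : ∀ {n a} → Card n a ≅ Card n a
reverseUpper-≅ {n} {a} = mk≅ (ρ-↔ n a)
  (λ {u} {v} → ρ-near compatible proj₂ {u} {v}) (λ {u} {v} → ρ-near compatible proj₂ {u} {v})
  where
  compatible : Compatible n a a a
  compatible = (λ _ → id) ,
    -- Only the last label `n - 1` is sent to `a`, and no step starts there.
    λ { {i} i<n eq _ refl → <⇒≢ i<n (+-cancelʳ-≡ a (suc i) n (trans (cong suc (+-comm i a)) eq)) }

reverseUpper-label : ∀ {G n a} (φ : G ≅ Card n a) v →
  Reflection n a (label φ v) (label (≅-trans φ reverseUpper-≅) v)
reverseUpper-label {a = a} φ v = ρ-spec a (to φ v)

-- Connectedness of the parts of a card

SameSide : ℕ → ℕ → ℕ → Set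
SameSide a i j = (i < a × j < a) ⊎ (a ≤ i × a ≤ j)

module _ {n a} (D : ℕ → Set) (closed : ∀ {i j} → i < n → j < n → Near a i j → D i → D j) where

  sweepUp : ∀ k i → k + i < n → (∀ w → i < w → w ≤ k + i → w ≢ a) → D i → D (k + i)
  sweepUp zero i _ _ d = d
  sweepUp (suc k) i lt free d =
    closed (<-trans (n<1+n _) lt) lt (inj₁ (refl , free _ (s≤s (m≤n+m i k)) ≤-refl))
      (sweepUp k i (<-trans (n<1+n _) lt) (λ w i<w w≤ → free w i<w (m≤n⇒m≤1+n w≤)) d)

  sweepDown : ∀ k i → k + i < n → (∀ w → i < w → w ≤ k + i → w ≢ a) → D (k + i) → D i
  sweepDown zero i _ _ d = d
  sweepDown (suc k) i lt free d =
    sweepDown k i (<-trans (n<1+n _) lt) (λ w i<w w≤ → free w i<w (m≤n⇒m≤1+n w≤))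
      (closed lt (<-trans (n<1+n _) lt) (inj₂ (refl , free _ (s≤s (m≤n+m i k)) ≤-refl)) d)

  sameSide-free : ∀ {i j} → SameSide a i j → ∀ w → i < w → w ≤ j → w ≢ a
  sameSide-free (inj₁ (_ , j<a)) w _ w≤j = <⇒≢ (≤-<-trans w≤j j<a)
  sameSide-free (inj₂ (a≤i , _)) w i<w _ = >⇒≢ (≤-<-trans a≤i i<w)

  -- Each step between two labels on one side of `a` ends at a label other than `a`, so it is an
  -- edge of the card and `D` spreads along it.
  sweep : ∀ {i j} → i < n → j < n → SameSide a i j → D i → D j
  sweep {i} {j} i<n j<n same d with ≤-total i j
  ... | inj₁ i≤j with m≤n⇒∃[o]m+o≡n i≤j
  ...   | k , refl rewrite +-comm i k = sweepUp k i j<n (sameSide-free same) d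
  sweep {i} {j} i<n j<n same d | inj₂ j≤i with m≤n⇒∃[o]m+o≡n j≤i
  ...   | k , refl rewrite +-comm j k = sweepDown k j i<n (sameSide-free (swapped same)) d
    where
    swapped : ∀ {i j} → SameSide a i j → SameSide a j i
    swapped (inj₁ (p , q)) = inj₁ (q , p)
    swapped (inj₂ (p , q)) = inj₂ (q , p)

-- Sizes of components

module _ (H : Graph) (e f : Edge H) where

  -- Counting: `s ≤ n` makes every label below `s` occur, and passing from it to the second label of
  -- its vertex is an injection into the labels below `t`.
  initial-≤ : ∀ {n a a' s t} (φ : H -ₑ e ≅ Card n a) (ψ : H -ₑ f ≅ Card n a') → s ≤ n →
    (∀ v → label φ v < s → label ψ v < t) → s ≤ t
  initial-≤ {s = s} {t} φ ψ s≤n incl = injective⇒≤ {f = g} g-inj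
    where
    vertex : (i : Fin s) → Σ[ v ∈ Vertex H ] label φ v ≡ toℕ i
    vertex i = label-surjective φ (≤-trans (toℕ<n i) s≤n)
    bound : ∀ i → label ψ (proj₁ (vertex i)) < t
    bound i = incl _ (subst (_< s) (sym (proj₂ (vertex i))) (toℕ<n i))
    g : Fin s → Fin t
    g i = fromℕ< (bound i)
    g-inj : ∀ {i j} → g i ≡ g j → i ≡ j
    g-inj {i} {j} eq = toℕ-injective
      (trans (sym (proj₂ (vertex i))) (trans (cong (label φ) same) (proj₂ (vertex j))))
      where
      same : proj₁ (vertex i) ≡ proj₁ (vertex j)
      same = label-injective ψ
        (trans (sym (toℕ-fromℕ< (bound i))) (trans (cong toℕ eq) (toℕ-fromℕ< (bound j))))

module _ (H : Graph) (e f : Edge H) {n a s : ℕ} (φ : H -ₑ e ≅ Card n a)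
         (0<s : 0 < s) (s<n : s < n)
         (closed : ∀ {u v} → Adj (H -ₑ f) u v → label φ u < s → label φ v < s) where

  module _ {a'} (ψ : H -ₑ f ≅ Card n a') where

    -- Membership in the set of vertices with `label φ v < s`, restated for labels of the second
    -- card so that `sweep` applies to it.
    Initial : ℕ → Set
    Initial i = ∀ v → label ψ v ≡ i → label φ v < s

    initial-closed : ∀ {i j} → i < n → j < n → Near a' i j → Initial i → Initial j
    initial-closed i<n j<n near d v refl with label-surjective ψ i<n
    ... | u , refl = closed (from-adj ψ near) (d u refl)

    initial-at : ∀ v → label φ v < s → Initial (label ψ v)
    initial-at v lt w eq = subst (λ z → label φ z < s) (sym (label-injective ψ eq)) lt

    initial-sweep : ∀ {u v} → SameSide a' (label ψ u) (label ψ v) → label φ u < s → label φ v < s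
    initial-sweep {u} {v} same lt =
      sweep Initial initial-closed (label<n ψ u) (label<n ψ v) same (initial-at u lt) v refl

    -- The set contains the first vertex of the lower part of the second card, hence that whole
    -- part. The vertex with first label `s` is outside, so it belongs to the upper part, which the
    -- set therefore misses.
    initial-size : ∀ {v} → label φ v < s → label ψ v ≡ 0 → 0 < a' → a' ≤ n → s ≡ a'
    initial-size {v} v<s v≡0 0<a' a'≤n = ≤-antisym
      (initial-≤ H e f φ ψ (<⇒≤ s<n) lower)
      (initial-≤ H f e ψ φ a'≤n λ w w<a' → initial-sweep (inj₁ (v<a' , w<a')) v<s)
      where
      v<a' : label ψ v < a'
      v<a' = subst (_< a') (sym v≡0) 0<a'
      out = label-surjective φ s<n
      u = proj₁ out
      u≮s : ¬ label φ u < s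
      u≮s lt = <⇒≢ lt (proj₂ out)
      u≥a' : a' ≤ label ψ u
      u≥a' = ≮⇒≥ λ lt → u≮s (initial-sweep (inj₁ (v<a' , lt)) v<s)
      lower : ∀ w → label φ w < s → label ψ w < a'
      lower w w<s with label ψ w <? a'
      ... | yes lt = lt
      ... | no ge = contradiction (initial-sweep (inj₂ (≮⇒≥ ge , u≥a')) w<s) u≮s

  -- The vertices with first label below `s` form a nonempty proper union of components of `H -ₑ f`,
  -- and that graph has just two components, of sizes `a'` and `b'`.
  initial-sizes : ∀ {a' b'} (ψ : H -ₑ f ≅ Card n a') → a' + b' ≡ n → 0 < a' → 0 < b' →
    s ≡ a' ⊎ s ≡ b'
  initial-sizes {a'} {b'} ψ sum 0<a' 0<b' with label-surjective ψ (≤-<-trans z≤n s<n)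
  ... | v , v≡0 with label φ v <? s
  ...   | yes v<s = inj₁ (initial-size ψ v<s v≡0 0<a' (≤-trans (m≤m+n a' b') (≤-reflexive sum)))
  -- The set now avoids the lower part and so meets the upper one; reversing the second labelling
  -- brings that part to the bottom.
  ...   | no v≮s = inj₂ (initial-size ψᵣ w<s w≡0 0<b' (≤-trans (m≤n+m b' a') (≤-reflexive sum)))
    where
    ψᵣ = ≅-trans ψ (reverse-≅ sum)
    end = label-surjective ψᵣ (≤-<-trans z≤n s<n)
    w = proj₁ end
    w≡0 = proj₂ end
    first = label-surjective φ (≤-<-trans z≤n s<n)
    u = proj₁ first
    u<s : label φ u < s
    u<s = subst (_< s) (sym (proj₂ first)) 0<s
    v<a' : label ψ v < a'
    v<a' = subst (_< a') (sym v≡0) 0<a'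
    u≥a' : a' ≤ label ψ u
    u≥a' = ≮⇒≥ λ lt → v≮s (initial-sweep ψ (inj₁ (lt , v<a')) u<s)
    w-last : suc (label ψ w) ≡ n
    w-last = trans (cong (λ z → suc (z + label ψ w)) (sym w≡0)) (reverse-label ψ sum w)
    w≥a' : a' ≤ label ψ w
    w≥a' = ≤-pred (≤-trans (m<m+n a' 0<b') (≤-reflexive (trans sum (sym w-last))))
    w<s : label φ w < s
    w<s = initial-sweep ψ (inj₂ (u≥a' , w≥a')) u<s

-- Degrees, and the ends of the deleted edge

near-degree : ∀ {a i j k l} → Near a i j → Near a i k → Near a i l → j ≢ k → j ≢ l → k ≢ l → ⊥
near-degree (inj₁ (refl , _)) (inj₁ (refl , _)) _ j≢k _ _ = j≢k refl
near-degree (inj₁ (refl , _)) (inj₂ _) (inj₁ (refl , _)) _ j≢l _ = j≢l refl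
near-degree (inj₁ _) (inj₂ (p , _)) (inj₂ (q , _)) _ _ k≢l = k≢l (suc-injective (trans p (sym q)))
near-degree (inj₂ _) (inj₁ (refl , _)) (inj₁ (refl , _)) _ _ k≢l = k≢l refl
near-degree (inj₂ (p , _)) (inj₁ _) (inj₂ (q , _)) _ j≢l _ = j≢l (suc-injective (trans p (sym q)))
near-degree (inj₂ (p , _)) (inj₂ (q , _)) _ j≢k _ _ = j≢k (suc-injective (trans p (sym q)))

degree≤2 : ∀ {G n a} (φ : G ≅ Card n a) {v x y z} →
  Adj G v x → Adj G v y → Adj G v z → x ≢ y → x ≢ z → y ≢ z → ⊥
degree≤2 φ vx vy vz x≢y x≢z y≢z =
  near-degree (to-adj φ vx) (to-adj φ vy) (to-adj φ vz)
    (x≢y ∘ label-injective φ) (x≢z ∘ label-injective φ) (y≢z ∘ label-injective φ)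

module _ (H : Graph) (e f : Edge H) (e≉f : ¬ _≈ₑ_ {H} e f) {n a a' b' : ℕ}
         (sum : a' + b' ≡ n) (0<a' : 0 < a') (0<b' : 0 < b') (a'≤ : a' ≤ suc a) (b'≤ : b' ≤ suc a)
         (ψ : H -ₑ f ≅ Card n a') where

  private
    x = src e
    y = tgt e

  -- Deleting the edge above y would cut off the labels 0, …, label y, which are
  -- too many for a component of the second card.
  upper-kept : (φ : H -ₑ e ≅ Card n a) → label φ x < a → a < label φ y →
    ∀ {z} → suc (label φ y) ≡ label φ z → ¬ SamePair y z (src f) (tgt f)
  upper-kept φ x<a a<y {z} y+1≡z yz≡f
    with initial-sizes H e f φ (s≤s z≤n) (subst (_< n) (sym y+1≡z) (label<n φ z)) closed
           ψ sum 0<a' 0<b'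
    where
    closed : ∀ {u v} → Adj (H -ₑ f) u v → label φ u < suc (label φ y) → label φ v < suc (label φ y)
    closed {u} {v} (adj , uv≢f) u<s with samePair? u v x y
    ... | yes (inj₁ (refl , refl)) = ≤-refl
    ... | yes (inj₂ (refl , refl)) = m≤n⇒m≤1+n (<-trans x<a a<y)
    ... | no uv≢e with to-adj φ (adj , uv≢e)
    ...   | inj₂ (v+1≡u , _) = <-trans (≤-reflexive v+1≡u) u<s
    ...   | inj₁ (u+1≡v , _) = ≤∧≢⇒< (subst (_≤ suc (label φ y)) u+1≡v u<s) v≢s
      where
      v≢s : label φ v ≢ suc (label φ y)
      v≢s eq with label-injective φ (suc-injective (trans u+1≡v eq))
                | label-injective φ (trans eq y+1≡z)
      ... | refl | refl = uv≢f yz≡f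
  ... | inj₁ refl = <⇒≱ (s≤s a<y) a'≤
  ... | inj₂ refl = <⇒≱ (s≤s a<y) b'≤

  -- The vertex `y` must be an end of the upper part, so reversing that part if necessary gives it
  -- the label `a`. The labels below `a` are untouched, which lets `join` treat the other end of `e`
  -- afterwards.
  straighten : (φ : H -ₑ e ≅ Card n a) → label φ x < a → a ≤ label φ y →
    Σ[ χ ∈ (H -ₑ e ≅ Card n a) ] (label χ x ≡ label φ x × label χ y ≡ a)
  straighten φ x<a a≤y with label φ y ≟ a
  ... | yes y≡a = φ , refl , y≡a
  ... | no y≢a = χ , χx≡ , χy≡a
    where
    a<y : a < label φ y
    a<y = ≤∧≢⇒< a≤y (y≢a ∘ sym)
    χ = ≅-trans φ reverseUpper-≅
    χx≡ : label χ x ≡ label φ x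
    χx≡ = reflection-low (reverseUpper-label φ x) x<a
    χ-sum : ∀ v → a ≤ label φ v → suc (label χ v + label φ v) ≡ n + a
    χ-sum v = reflection-high (reverseUpper-label φ v)
    χy≡a : label χ y ≡ a
    χy≡a with label χ y ≟ a
    ... | yes eq = eq
    ... | no χy≢a with suc (label φ y) ≟ n
    ...   | yes last = +-cancelʳ-≡ n (label χ y) a
              (trans (cong (label χ y +_) (sym last))
                (trans (+-suc _ _) (trans (χ-sum y a≤y) (+-comm n a))))
    -- The three neighbours of `y` in `H -ₑ f` are `y⁺`, `y⁻` and `x`. Applied to `φ`, `upper-kept`
    -- keeps the edge to `y⁺`; applied to `χ`, where `y⁻` follows `y`, it keeps the edge to `y⁻`.
    ...   | no ¬last = ⊥-elim (degree≤2 ψ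
              (adj⁺ , upper-kept φ x<a a<y (sym y⁺≡))
              (adj⁻ , upper-kept χ (subst (_< a) (sym χx≡) x<a) a<χy χy+1≡)
              (symm H (adj e) , e≉f ∘ samePair-swap)
              (>⇒≢ (<-trans y⁻<y y<y⁺) ∘ cong (label φ))
              (>⇒≢ (<-trans x<y y<y⁺) ∘ cong (label φ))
              (>⇒≢ (<-≤-trans x<a a≤y⁻) ∘ cong (label φ)))
      where
      above = label-surjective φ (≤∧≢⇒< (label<n φ y) ¬last)
      y⁺ = proj₁ above
      y⁺≡ : label φ y⁺ ≡ suc (label φ y)
      y⁺≡ = proj₂ above
      predecessor : ∀ {k m} → k < m → m < n → Σ[ v ∈ Vertex H ] (suc (label φ v) ≡ m × k ≤ label φ v)
      predecessor {m = suc m} (s≤s k≤m) m<n with label-surjective φ (<-trans (n<1+n m) m<n)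
      ... | v , refl = v , refl , k≤m
      below = predecessor a<y (label<n φ y)
      y⁻ = proj₁ below
      y⁻+1≡ : suc (label φ y⁻) ≡ label φ y
      y⁻+1≡ = proj₁ (proj₂ below)
      a≤y⁻ : a ≤ label φ y⁻
      a≤y⁻ = proj₂ (proj₂ below)
      y<y⁺ : label φ y < label φ y⁺
      y<y⁺ = ≤-reflexive (sym y⁺≡)
      y⁻<y : label φ y⁻ < label φ y
      y⁻<y = ≤-reflexive y⁻+1≡
      x<y : label φ x < label φ y
      x<y = <-trans x<a a<y
      adj⁺ : Adj H y y⁺
      adj⁺ = proj₁ (from-adj φ (inj₁ (sym y⁺≡ , λ eq → <⇒≢ (<-trans a<y y<y⁺) (sym eq))))
      adj⁻ : Adj H y y⁻
      adj⁻ = proj₁ (from-adj φ (inj₂ (y⁻+1≡ , λ eq → <⇒≢ a<y (sym eq))))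
      χy+1≡ : suc (label χ y) ≡ label χ y⁻
      χy+1≡ = +-cancelʳ-≡ (label φ y⁻) _ _ (suc-injective
        (trans (cong suc (sym (+-suc (label χ y) (label φ y⁻))))
          (trans (cong (λ z → suc (label χ y + z)) y⁻+1≡)
            (trans (χ-sum y a≤y) (sym (χ-sum y⁻ a≤y⁻))))))
      a<χy : a < label χ y
      a<χy = ≤∧≢⇒< (reflection-≥ (reverseUpper-label φ y) a≤y) (χy≢a ∘ sym)

-- Recovering the path from its cards

module _ (H : Graph) (e : Edge H) {n a : ℕ} where

  -- The step into `a` is the only one missing from the card, and `e` supplies exactly this step.
  extend : (φ : H -ₑ e ≅ Card n a) → suc (label φ (src e)) ≡ a → label φ (tgt e) ≡ a → H ≅ P n
  extend φ x+1≡a y≡a = record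
    { bij = bij φ ; adj-iff = λ u v → mk⇔ (there {u} {v}) back }
    where
    edge-labels : suc (label φ (src e)) ≡ label φ (tgt e)
    edge-labels = trans x+1≡a (sym y≡a)
    there : ∀ {u v} → Adj H u v → Adj (P n) (to φ u) (to φ v)
    there {u} {v} uv with samePair? u v (src e) (tgt e)
    ... | yes (inj₁ (refl , refl)) = inj₁ edge-labels
    ... | yes (inj₂ (refl , refl)) = inj₂ edge-labels
    ... | no ne = ⊎-map proj₁ proj₁ (to-adj φ (uv , ne))
    forward : ∀ {u v} → suc (label φ u) ≡ label φ v → Adj H u v
    forward {u} {v} eq with label φ v ≟ a
    ... | no v≢a = proj₁ (from-adj φ (inj₁ (eq , v≢a)))
    ... | yes v≡a = subst₂ (Adj H)
      (label-injective φ (suc-injective (trans x+1≡a (sym (trans eq v≡a)))))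
      (label-injective φ (trans y≡a (sym v≡a)))
      (adj e)
    back : ∀ {u v} → Adj (P n) (to φ u) (to φ v) → Adj H u v
    back (inj₁ eq) = forward eq
    back (inj₂ eq) = symm H (forward eq)

module _ (H : Graph) (f : Edge H) {n a b a' b' : ℕ} (a+b≡n : a + b ≡ n)
         (sum : a' + b' ≡ n) (0<a' : 0 < a') (0<b' : 0 < b')
         (a'≤a : a' ≤ suc a) (b'≤a : b' ≤ suc a) (a'≤b : a' ≤ suc b) (b'≤b : b' ≤ suc b)
         (ψ : H -ₑ f ≅ Card n a') where

  -- Straighten twice. The first time `tgt e` becomes the bottom of the upper part. Reversing all
  -- labels and flipping `e` exchanges the two parts, so `tgt e` gets label `b - 1`; the second time
  -- moves `src e` to `b` and keeps `b - 1` in place.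
  join : (e : Edge H) → ¬ _≈ₑ_ {H} e f → (φ : H -ₑ e ≅ Card n a) →
    label φ (src e) < a → a ≤ label φ (tgt e) → H ≅ P n
  join e e≉f φ x<a a≤y = extend H e̅ χ̅ (trans (cong suc χ̅y≡) y₂+1≡b) χ̅x≡b
    where
    e̅ = flip {H} e
    e̅≉f : ¬ _≈ₑ_ {H} e̅ f
    e̅≉f = e≉f ∘ samePair-swap
    straight = straighten H e f e≉f sum 0<a' 0<b' a'≤a b'≤a ψ φ x<a a≤y
    χ = proj₁ straight
    reversed : H -ₑ e̅ ≅ Card n b
    reversed = ≅-trans (≅-trans (flip-≅ e) χ) (reverse-≅ a+b≡n)
    reversed-sum : ∀ v → suc (label reversed v + label χ v) ≡ n
    reversed-sum = reverse-label (≅-trans (flip-≅ e) χ) a+b≡n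
    y₂+1≡b : suc (label reversed (tgt e)) ≡ b
    y₂+1≡b = +-cancelʳ-≡ a _ b (trans
      (cong (λ z → suc (label reversed (tgt e) + z)) (sym (proj₂ (proj₂ straight))))
      (trans (reversed-sum (tgt e)) (trans (sym a+b≡n) (+-comm a b))))
    x₁<a : label χ (src e) < a
    x₁<a = subst (_< a) (sym (proj₁ (proj₂ straight))) x<a
    b≤x₂ : b ≤ label reversed (src e)
    b≤x₂ = +-cancelʳ-≤ a b _ (≤-trans (≤-reflexive (trans (+-comm b a) (trans a+b≡n
      (trans (sym (reversed-sum (src e))) (sym (+-suc _ _))))))
      (+-monoʳ-≤ _ x₁<a))
    straight̅ = straighten H e̅ f e̅≉f sum 0<a' 0<b' a'≤b b'≤b ψ reversed (≤-reflexive y₂+1≡b) b≤x₂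
    χ̅ = proj₁ straight̅
    χ̅y≡ = proj₁ (proj₂ straight̅)
    χ̅x≡b = proj₂ (proj₂ straight̅)

  -- If e joins two vertices of the same part of the first card, then the labels below a still
  -- form a union of components after deleting g, so the third card has a part of size a.
  reconstruct : (e g : Edge H) → ¬ _≈ₑ_ {H} e f → (φ : H -ₑ e ≅ Card n a) →
    ∀ {a'' b''} → H -ₑ g ≅ Card n a'' → a'' + b'' ≡ n → 0 < a'' → 0 < b'' →
    a ≢ a'' → a ≢ b'' → 0 < a → a < n → H ≅ P n
  reconstruct e g e≉f φ {a''} {b''} θ sum'' 0<a'' 0<b'' a≢a'' a≢b'' 0<a a<n =
    go (label φ (src e) <? a) (label φ (tgt e) <? a)
    where
    uncrossed : ((label φ (src e) < a → label φ (tgt e) < a) ×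
                 (label φ (tgt e) < a → label φ (src e) < a)) → ⊥
    uncrossed (xy , yx) = [ a≢a'' , a≢b'' ]
      (initial-sizes H e g φ 0<a a<n closed θ sum'' 0<a'' 0<b'')
      where
      closed : ∀ {u v} → Adj (H -ₑ g) u v → label φ u < a → label φ v < a
      closed {u} {v} (adj , _) u<a with samePair? u v (src e) (tgt e)
      ... | yes (inj₁ (refl , refl)) = xy u<a
      ... | yes (inj₂ (refl , refl)) = yx u<a
      ... | no ne with to-adj φ (adj , ne)
      ...   | inj₁ (eq , v≢a) = ≤∧≢⇒< (subst (_≤ a) eq u<a) v≢a
      ...   | inj₂ (eq , _) = <-trans (≤-reflexive eq) u<a
    go : Dec (label φ (src e) < a) → Dec (label φ (tgt e) < a) → H ≅ P n
    go (yes x<a) (no y≮a) = join e e≉f φ x<a (≮⇒≥ y≮a)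
    go (no x≮a) (yes y<a) = join (flip {H} e)
      (e≉f ∘ samePair-swap)
      (≅-trans (flip-≅ e) φ) y<a (≮⇒≥ x≮a)
    go (yes x<a) (yes y<a) = ⊥-elim (uncrossed ((λ _ → y<a) , (λ _ → x<a)))
    go (no x≮a) (no y≮a) = ⊥-elim (uncrossed ((λ x<a → contradiction x<a x≮a) , (λ y<a → contradiction y<a y≮a)))

-- Cards of the path

card-≅ : ∀ {n} (e : Edge (P n)) → suc (toℕ (src e)) ≡ toℕ (tgt e) → P n -ₑ e ≅ Card n (toℕ (tgt e))
card-≅ {n} e x+1≡y = mk≅ ↔-refl
  (λ { {u} {v} (inj₁ eq , ne) → inj₁ (kept u v eq ne)
     ; {u} {v} (inj₂ eq , ne) → inj₂ (kept v u eq (ne ∘ samePair-swap)) })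
  (λ { {u} {v} (inj₁ (eq , v≢y)) → inj₁ eq , distinct u v eq v≢y
     ; {u} {v} (inj₂ (eq , u≢y)) → inj₂ eq , distinct v u eq u≢y ∘ samePair-swap })
  where
  kept : ∀ u v → suc (toℕ u) ≡ toℕ v → ¬ SamePair u v (src e) (tgt e) → Step (toℕ (tgt e)) (toℕ u) (toℕ v)
  kept u v eq ne = eq , λ v≡y →
    ne (inj₁ (toℕ-injective (suc-injective (trans eq (trans v≡y (sym x+1≡y)))) , toℕ-injective v≡y))
  distinct : ∀ u v → suc (toℕ u) ≡ toℕ v → toℕ v ≢ toℕ (tgt e) → ¬ SamePair u v (src e) (tgt e)
  distinct u v eq v≢y (inj₁ (_ , refl)) = v≢y refl
  distinct u v eq v≢y (inj₂ (refl , refl)) =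
    <-asym (≤-reflexive eq) (≤-reflexive x+1≡y)

card : ∀ {n} (e : Edge (P n)) → ∃[ a ] (0 < a × a < n × P n -ₑ e ≅ Card n a)
card e@(edge x y (inj₁ eq)) = toℕ y , subst (0 <_) eq (s≤s z≤n) , toℕ<n y , card-≅ e eq
card {n} e@(edge x y (inj₂ eq)) = toℕ x , subst (0 <_) eq (s≤s z≤n) , toℕ<n x ,
  ≅-trans (≅-sym (flip-≅ e)) (card-≅ (flip {P n} e) eq)

largerCard : ∀ {n} (e : Edge (P n)) → ∃[ a ] (a < n × n ≤ a + a × P n -ₑ e ≅ Card n a)
largerCard {n} e with card e
... | a , 0<a , a<n , φ with n ≤? a + a
...   | yes n≤2a = a , a<n , n≤2a , φ
...   | no n≰2a with m≤n⇒∃[o]m+o≡n (<⇒≤ a<n)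
...     | b , a+b≡n =
  b , subst (b <_) a+b≡n (m<n+m b 0<a) , subst (_≤ b + b) a+b≡n (+-monoˡ-≤ b a≤b) ,
  ≅-trans φ (reverse-≅ a+b≡n)
  where
  a≤b : a ≤ b
  a≤b = +-cancelˡ-≤ a a b (subst (a + a ≤_) (sym a+b≡n) (<⇒≤ (≰⇒> n≰2a)))

-- Other graphs with the same cards

Foil : (n a a' : ℕ) → Set₁
Foil n a a' = Σ[ H ∈ Graph ] Σ[ e ∈ Edge H ] Σ[ f ∈ Edge H ]
  (¬ _≈ₑ_ {H} e f × H -ₑ e ≅ Card n a × H -ₑ f ≅ Card n a' × ¬ H ≅ P n)

Hook : ℕ → ℕ → ℕ → ℕ → Set
Hook n x i j = i ≡ x × suc j ≡ n

-- The first card with its vertex x joined to the last vertex n - 1. Reflecting x + 1, …, n - 1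
-- exchanges this new edge with {x, x + 1}.
module _ (n x a a' : ℕ) (p<n : suc (suc x) < n) (p≢a : suc x ≢ a) (p≢a' : suc x ≢ a')
         (there : Compatible n (suc x) a a') (back : Compatible n (suc x) a' a) where

  private
    p = suc x

  Hooked : Graph
  Hooked = record
    { order  = n
    ; Adj    = λ i j → Near a (toℕ i) (toℕ j) ⊎ (Hook n x (toℕ i) (toℕ j) ⊎ Hook n x (toℕ j) (toℕ i))
    ; adj?   = λ i j → near? a (toℕ i) (toℕ j) ⊎-dec
        ((toℕ i ≟ x ×-dec suc (toℕ j) ≟ n) ⊎-dec (toℕ j ≟ x ×-dec suc (toℕ i) ≟ n))
    ; symm   = ⊎-map ⊎-swap ⊎-swap
    ; irrefl = [ near-irrefl , [ no-loop , no-loop ] ]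
    }
    where
    no-loop : ∀ {i} → ¬ Hook n x i i
    no-loop (refl , eq) = <⇒≢ (<-trans (n<1+n _) p<n) eq

  private
    predecessor : ∀ {m} → m < n → Σ[ k ∈ Fin n ] suc (toℕ k) ≡ n
    predecessor {m} (s≤s {n = k} _) = fromℕ< (n<1+n k) , cong suc (toℕ-fromℕ< (n<1+n k))
    last = proj₁ (predecessor p<n)
    last+1≡n : suc (toℕ last) ≡ n
    last+1≡n = proj₂ (predecessor p<n)
    x<n : x < n
    x<n = <-trans (n<1+n x) (<-trans (n<1+n p) p<n)
    vx vp : Fin n
    vx = fromℕ< x<n
    vp = fromℕ< (<-trans (n<1+n p) p<n)
    vx≡ : toℕ vx ≡ x
    vx≡ = toℕ-fromℕ< x<n
    vp≡ : toℕ vp ≡ p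
    vp≡ = toℕ-fromℕ< (<-trans (n<1+n p) p<n)

  hook : Edge Hooked
  hook = edge vx last (inj₂ (inj₁ (vx≡ , last+1≡n)))

  bridge : Edge Hooked
  bridge = edge vx vp (inj₁ (inj₁ (trans (cong suc vx≡) (sym vp≡) , λ eq → p≢a (trans (sym vp≡) eq))))

  vp≢last : vp ≢ last
  vp≢last eq = <⇒≢ p<n (trans (cong suc (trans (sym vp≡) (cong toℕ eq))) last+1≡n)

  hook≉bridge : ¬ _≈ₑ_ {Hooked} hook bridge
  hook≉bridge (inj₁ (_ , eq)) = vp≢last (sym eq)
  hook≉bridge (inj₂ (eq , _)) = 1+n≢n (trans (sym vp≡) (trans (cong toℕ (sym eq)) vx≡))

  private
    isHook : ∀ {u v} → Hook n x (toℕ u) (toℕ v) → SamePair u v vx last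
    isHook (u≡x , v+1≡n) =
      inj₁ (toℕ-injective (trans u≡x (sym vx≡)) , toℕ-injective (suc-injective (trans v+1≡n (sym last+1≡n))))
    step-not-hook : ∀ {u v} → suc (toℕ u) ≡ toℕ v → ¬ SamePair u v vx last
    step-not-hook eq (inj₁ (refl , refl)) = <⇒≢ p<n
      (trans (cong (λ z → suc (suc z)) (sym vx≡)) (trans (cong suc eq) last+1≡n))
    step-not-hook eq (inj₂ (refl , refl)) =
      <⇒≢ x<n (trans (sym vx≡) (trans (sym eq) last+1≡n))

  hook-card : Hooked -ₑ hook ≅ Card n a
  hook-card = mk≅ ↔-refl
    (λ { (inj₁ near , _) → near
       ; {u} {v} (inj₂ (inj₁ h) , ne) → contradiction (isHook {u} {v} h) ne
       ; {u} {v} (inj₂ (inj₂ h) , ne) → contradiction (isHook {v} {u} h) (ne ∘ samePair-swap) })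
    (λ { near@(inj₁ (eq , _)) → inj₁ near , step-not-hook eq
       ; near@(inj₂ (eq , _)) → inj₁ near , step-not-hook eq ∘ samePair-swap })

  private
    step-joint : ∀ {u v} → suc (toℕ u) ≡ toℕ v → ¬ SamePair u v vx vp → toℕ v ≢ p
    step-joint eq ne v≡p = ne (inj₁
      (toℕ-injective (trans (suc-injective (trans eq v≡p)) (sym vx≡)) , toℕ-injective (trans v≡p (sym vp≡))))
    step-not-bridge : ∀ {u v} → suc (toℕ u) ≡ toℕ v → toℕ v ≢ p → ¬ SamePair u v vx vp
    step-not-bridge eq v≢p (inj₁ (_ , refl)) = v≢p vp≡
    step-not-bridge eq v≢p (inj₂ (refl , refl)) =
      <-asym (≤-reflexive eq) (≤-reflexive (trans (cong suc vx≡) (sym vp≡)))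
    ρ-x : ∀ {i : Fin n} → toℕ i ≡ x → toℕ (ρ p i) ≡ x
    ρ-x {i} refl = reflection-low (ρ-spec p i) ≤-refl
    ρ-sum : ∀ {i : Fin n} → p ≤ toℕ i → toℕ (ρ p i) + suc (toℕ i) ≡ n + p
    ρ-sum {i} p≤i = trans (+-suc _ _) (reflection-high (ρ-spec p i) p≤i)
    ρ-last : ∀ {i : Fin n} → suc (toℕ i) ≡ n → toℕ (ρ p i) ≡ p
    ρ-last {i} i+1≡n = +-cancelʳ-≡ n _ p (trans (cong (toℕ (ρ p i) +_) (sym i+1≡n))
      (trans (ρ-sum {i} (≤-pred (subst (p <_) (sym i+1≡n) (<-trans (n<1+n p) p<n)))) (+-comm n p)))
    ρ-p : ∀ {i : Fin n} → toℕ i ≡ p → suc (toℕ (ρ p i)) ≡ n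
    ρ-p {i} i≡p = +-cancelʳ-≡ p _ n
      (trans (sym (+-suc _ p)) (trans (cong (λ z → toℕ (ρ p i) + suc z) (sym i≡p)) (ρ-sum {i} (≤-reflexive (sym i≡p)))))

    hook⇒bridge : ∀ {u v} → Hook n x (toℕ u) (toℕ v) → Step a' (toℕ (ρ p u)) (toℕ (ρ p v))
    hook⇒bridge {u} {v} (u≡x , v+1≡n) =
      trans (cong suc (ρ-x {u} u≡x)) (sym (ρ-last {v} v+1≡n)) , λ eq → p≢a' (trans (sym (ρ-last {v} v+1≡n)) eq)

    step-there : ∀ {u v} → Step a (toℕ u) (toℕ v) → ¬ SamePair u v vx vp →
                 Near a' (toℕ (ρ p u)) (toℕ (ρ p v))
    step-there {u} {v} s ne = ⊎-map proj₁ proj₁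
      (reflection-step there (toℕ<n v) (ρ-spec p u) (ρ-spec p v) s (step-joint (proj₁ s) ne))

    step-back : ∀ {u v} → Step a' (toℕ u) (toℕ v) → Adj (Hooked -ₑ bridge) (ρ p u) (ρ p v)
    step-back {u} {v} s@(eq , _) with toℕ v ≟ p
    -- The reversal fixes `x` and exchanges `p` with `n - 1`, so the step from `x` to `p` comes from
    -- the hook. All other steps come from steps that avoid the bridge.
    ... | yes v≡p = inj₂ (inj₁ (ρ-x {u} (suc-injective (trans eq v≡p)) , ρ-p {v} v≡p)) ,
      λ { (inj₁ (_ , ρv≡vp)) → <⇒≢ p<n (trans (cong suc (sym (trans (cong toℕ ρv≡vp) vp≡))) (ρ-p {v} v≡p))
        ; (inj₂ (_ , ρv≡vx)) → <⇒≢ (<-trans (n<1+n p) p<n)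
            (trans (cong suc (sym (trans (cong toℕ ρv≡vx) vx≡))) (ρ-p {v} v≡p)) }
    ... | no v≢p with reflection-step back (toℕ<n v) (ρ-spec p u) (ρ-spec p v) s v≢p
    ...   | inj₁ (s' , j≢p) = inj₁ (inj₁ s') , step-not-bridge (proj₁ s') j≢p
    ...   | inj₂ (s' , j≢p) = inj₁ (inj₂ s') , step-not-bridge (proj₁ s') j≢p ∘ samePair-swap

  bridge-card : Hooked -ₑ bridge ≅ Card n a'
  bridge-card = mk≅ (ρ-↔ n p)
    (λ { {u} {v} (inj₁ (inj₁ s) , ne) → step-there {u} {v} s ne
       ; {u} {v} (inj₁ (inj₂ s) , ne) → ⊎-swap (step-there {v} {u} s (ne ∘ samePair-swap))
       ; {u} {v} (inj₂ (inj₁ h) , _) → inj₁ (hook⇒bridge {u} {v} h)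
       ; {u} {v} (inj₂ (inj₂ h) , _) → inj₂ (hook⇒bridge {v} {u} h) })
    (λ { {u} {v} (inj₁ s) → step-back {u} {v} s
       ; {u} {v} (inj₂ s) → symm (Hooked -ₑ bridge) {ρ p v} {ρ p u} (step-back {v} {u} s) })

  hooked-foil : ¬ Hooked ≅ P n → Foil n a a'
  hooked-foil ≇ = Hooked , hook , bridge , hook≉bridge , hook-card , bridge-card , ≇

  -- Besides `x + 1` and `n - 1`, the vertex `x` has the neighbour `x - 1`, so its degree is at
  -- least 3.
  spider≇P : 0 < x → x ≢ a → ¬ Hooked ≅ P n
  spider≇P 0<x x≢a φ with pred′ 0<x
    where
    pred′ : ∀ {m} → 0 < m → ∃[ k ] suc k ≡ m
    pred′ (s≤s _) = _ , refl
  ... | w , w+1≡x = degree≤2 (≅-trans φ (P≅Card₀ n))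
    (adj bridge) (adj hook)
    (inj₁ (inj₂ (trans (cong suc vw≡) (trans w+1≡x (sym vx≡)) , λ eq → x≢a (trans (sym vx≡) eq))))
    vp≢last
    (λ eq → >⇒≢ (<-trans w<x (n<1+n x)) (trans (sym vp≡) (trans (cong toℕ eq) vw≡)))
    (λ eq → <⇒≢ (≤-<-trans w<x x<n) (trans (cong suc (trans (sym vw≡) (cong toℕ (sym eq)))) last+1≡n))
    where
    w<x : w < x
    w<x = ≤-reflexive w+1≡x
    vw : Fin n
    vw = fromℕ< (<-trans w<x x<n)
    vw≡ : toℕ vw ≡ w
    vw≡ = toℕ-fromℕ< (<-trans w<x x<n)

  -- Here the last vertex is `x + 2`, so the hook closes the triangle on `x`, `x + 1`, `x + 2`.
  triangle≇P : 3 + x ≡ n → a ≢ suc p → ¬ Hooked ≅ P n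
  triangle≇P refl a≢ φ =
    no-triangle (to φ vx) (to φ vp) (to φ last) (to-adj φ {vx} {vp} (adj bridge)) (to-adj φ {vp} {last} vp-last) (to-adj φ {vx} {last} (adj hook))
    where
    last≡ : toℕ last ≡ suc p
    last≡ = suc-injective last+1≡n
    vp-last : Adj Hooked vp last
    vp-last = inj₁ (inj₁ (trans (cong suc vp≡) (sym last≡) , λ eq → a≢ (trans (sym eq) last≡)))
    no-triangle : ∀ u v w → Adj (P n) u v → Adj (P n) v w → ¬ Adj (P n) u w
    no-triangle u v w uv vw uw = go uv vw uw
      where
      go : ∀ {i j k} → suc i ≡ j ⊎ suc j ≡ i → suc j ≡ k ⊎ suc k ≡ j → ¬ (suc i ≡ k ⊎ suc k ≡ i)
      go (inj₁ refl) (inj₁ refl) (inj₁ eq) = 1+n≢n (sym (suc-injective eq))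
      go (inj₁ refl) (inj₁ refl) (inj₂ eq) = <⇒≢ (m<n+m _ {3} (s≤s z≤n)) (sym eq)
      go (inj₁ refl) (inj₂ refl) (inj₁ eq) = 1+n≢n eq
      go (inj₁ refl) (inj₂ refl) (inj₂ eq) = 1+n≢n eq
      go (inj₂ refl) (inj₁ refl) (inj₁ eq) = 1+n≢n eq
      go (inj₂ refl) (inj₁ refl) (inj₂ eq) = 1+n≢n eq
      go (inj₂ refl) (inj₂ refl) (inj₁ eq) = <⇒≢ (m<n+m _ {3} (s≤s z≤n)) (sym eq)
      go (inj₂ refl) (inj₂ refl) (inj₂ eq) = 1+n≢n (sym (suc-injective eq))

-- The centre `x` has legs of lengths `x`, `a - 1 - x` and `n - a`, all positive.
spiderFoil : ∀ {n a a'} → a < n → a' < n → n + 2 ≤ a + a' → Foil n a a'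
spiderFoil {n} {a} {a'} a<n a'<n large with m≤n⇒∃[o]m+o≡n large
... | t , sum = hooked-foil n x a a' (≤-<-trans p<a a<n) (<⇒≢ p<a) (<⇒≢ p<a')
                  there back
                  (spider≇P n x a a' (≤-<-trans p<a a<n) (<⇒≢ p<a) (<⇒≢ p<a') there back
                    (s≤s z≤n) (<⇒≢ (<-trans (n<1+n x) p<a)))
  where
  -- This makes `p = x + 1` equal to `a + a' - n`, so that reversing the labels from `p` on carries
  -- the gap `a` to `a'`.
  x = suc t
  a+a'≡n+p : a + a' ≡ n + suc x
  a+a'≡n+p = trans (sym sum) (+-assoc n 2 t)
  p<a : suc x < a
  p<a = +-cancelˡ-< n (suc x) a (subst (_< n + a) a+a'≡n+p (subst (_< n + a) (+-comm a' a) (+-monoˡ-< a a'<n)))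
  p<a' : suc x < a'
  p<a' = +-cancelˡ-< n (suc x) a' (subst (_< n + a') a+a'≡n+p (+-monoˡ-< a' a<n))
  there = compatible-sum (<⇒≤ p<a') a+a'≡n+p
  back = compatible-sum (<⇒≤ p<a) (trans (+-comm a' a) a+a'≡n+p)

-- The reversal merely exchanges `x + 1` and `x + 2`. The gap `a` lies below them and stays put, so
-- deleting either triangle edge at `x` leaves the same card.
triangleFoil : ∀ {n x a} → 3 + x ≡ n → a ≤ x → Foil n a a
triangleFoil {n} {x} {a} refl a≤x = hooked-foil n x a a ≤-refl p≢a p≢a compatible compatible
  (triangle≇P n x a a ≤-refl p≢a p≢a compatible compatible refl (<⇒≢ (s≤s (m≤n⇒m≤1+n a≤x))))
  where
  p≢a : suc x ≢ a
  p≢a = >⇒≢ (s≤s a≤x)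
  compatible : Compatible n (suc x) a a
  compatible = (λ _ → id) , λ { {i} i<n eq _ refl →
    <⇒≢ (+-mono-≤-< (m≤n⇒m≤1+n a≤x) i<n) (trans (+-suc a i) (trans eq (+-comm n (suc x)))) }

-- Lower bounds

-- Without cards every graph qualifies, in particular the empty one.
0-irreconstructible : ∀ {n} → 0 < n → ¬ ReconstructibleFrom (P n) 0
0-irreconstructible {suc n} _ (e , _ , rec) with from (rec (P 0) (λ ()) (λ { {()} }) (λ ())) zero
... | ()

-- The given card is paired with the one whose larger part is `k = n - 1`. As `n ≥ 5`, the larger
-- part `a` of the given card is at least 3, so `a + k ≥ n + 2` and a spider has both cards.
1-irreconstructible : ∀ {n} → 5 ≤ n → ¬ ReconstructibleFrom (P n) 1
1-irreconstructible {suc k} 5≤n (e , _ , rec) with largerCard (e zero)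
... | a , a<n , n≤2a , φ with spiderFoil {suc k} {a} {k} a<n (n<1+n k) large
  where
  3≤a : 3 ≤ a
  3≤a = ≮⇒≥ λ { (s≤s a≤2) → <⇒≱ (≤-trans 5≤n n≤2a) (+-mono-≤ a≤2 a≤2) }
  large : suc k + 2 ≤ a + k
  large = ≤-trans (≤-reflexive (trans (sym (+-suc k 2)) (+-comm k 3))) (+-monoˡ-≤ k 3≤a)
...   | H , f , _ , _ , ψ , _ , H≇P =
  H≇P (rec H (λ _ → f) (λ { {zero} {zero} _ → refl }) (λ { zero → ≅-trans ψ (≅-sym φ) }))

-- Both larger parts are at least `m + 1`. Unless both equal `m + 1`, their sum is at least
-- `2m + 3 = n + 2` and a spider applies.
2-irreconstructible : ∀ {n m} → n ≡ suc (m + m) → 2 ≤ m → ¬ ReconstructibleFrom (P n) 2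
2-irreconstructible {n} {m} refl (s≤s (s≤s {n = t} z≤n)) (e , _ , rec)
  with largerCard (e zero) | largerCard (e (suc zero))
... | a , a<n , n≤2a , φ | a' , a'<n , n≤2a' , φ' = refute (a ≟ suc m) (a' ≟ suc m)
  where
  m<half : ∀ {a} → n ≤ a + a → m < a
  m<half n≤2a = ≰⇒> λ a≤m → <⇒≱ n≤2a (+-mono-≤ a≤m a≤m)
  useFoil : ∀ {c c'} → Foil n c c' → Card n c ≅ P n -ₑ e zero → Card n c' ≅ P n -ₑ e (suc zero) → ⊥
  useFoil (H , f , f' , f≉f' , ψ , ψ' , H≇P) χ χ' = H≇P (rec H fs
    (λ { {zero} {zero} _ → refl
       ; {zero} {suc zero} eq → contradiction eq f≉f'
       ; {suc zero} {zero} eq → contradiction (samePair-sym eq) f≉f'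
       ; {suc zero} {suc zero} _ → refl })
    (λ { zero → ≅-trans ψ χ ; (suc zero) → ≅-trans ψ' χ' }))
    where
    fs : Fin 2 → Edge H
    fs zero = f
    fs (suc _) = f'
  spider : n + 2 ≤ a + a' → ⊥
  spider large = useFoil (spiderFoil a<n a'<n large) (≅-sym φ) (≅-sym φ')
  n+2≡ : n + 2 ≡ suc (suc m + suc m)
  n+2≡ = trans (+-comm n 2) (cong (λ z → suc (suc z)) (sym (+-suc m m)))
  refute : Dec (a ≡ suc m) → Dec (a' ≡ suc m) → ⊥
  refute (yes refl) (yes refl) =
    -- Since `m = t + 2`, the triangle starts at `n - 3 = t + m`. The cards are reversed to put the
    -- smaller part, of size `m`, below it.
    useFoil (triangleFoil {n} {t + m} refl (m≤n+m m t))
      (≅-trans (reverse-≅ (+-suc m m)) (≅-sym φ)) (≅-trans (reverse-≅ (+-suc m m)) (≅-sym φ'))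
  refute (no a≢) _ = spider (subst (_≤ a + a') (sym n+2≡)
    (+-mono-≤ (≤∧≢⇒< (m<half n≤2a) (a≢ ∘ sym)) (m<half n≤2a')))
  refute (yes _) (no a'≢) = spider (subst (_≤ a + a') (trans (+-suc (suc m) (suc m)) (sym n+2≡))
    (+-mono-≤ (m<half n≤2a) (≤∧≢⇒< (m<half n≤2a') (a'≢ ∘ sym))))

-- Upper bounds from edges near the middle

pathEdge : ∀ {n i} → suc i < n → Edge (P n)
pathEdge {n} {i} lt = edge (fromℕ< (<-trans (n<1+n i) lt)) (fromℕ< lt)
  (inj₁ (trans (cong suc (toℕ-fromℕ< (<-trans (n<1+n i) lt))) (sym (toℕ-fromℕ< lt))))

module _ {n : ℕ} (j k : ℕ) (j+k<n : j + k < n) where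

  private
    index<n : (i : Fin j) → suc (toℕ i + k) < n
    index<n i = ≤-<-trans (+-monoˡ-≤ k (toℕ<n i)) j+k<n

  consecutiveEdges : Fin j → Edge (P n)
  consecutiveEdges i = pathEdge (index<n i)

  private
    src≡ : ∀ i → toℕ (src (consecutiveEdges i)) ≡ toℕ i + k
    src≡ i = toℕ-fromℕ< _
    tgt≡ : ∀ i → toℕ (tgt (consecutiveEdges i)) ≡ suc (toℕ i + k)
    tgt≡ i = toℕ-fromℕ< (index<n i)

  consecutive-distinct : Distinct {P n} consecutiveEdges
  consecutive-distinct {i} {i'} (inj₁ (eq , _)) = toℕ-injective
    (+-cancelʳ-≡ k (toℕ i) (toℕ i') (trans (sym (src≡ i)) (trans (cong toℕ eq) (src≡ i'))))
  consecutive-distinct {i} {i'} (inj₂ (eq , eq')) = ⊥-elim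
    (<-asym (≤-reflexive (trans (sym (tgt≡ i')) (trans (cong toℕ (sym eq)) (src≡ i))))
            (≤-reflexive (trans (sym (tgt≡ i)) (trans (cong toℕ eq') (src≡ i')))))

  consecutive-card : ∀ i → P n -ₑ consecutiveEdges i ≅ Card n (suc (toℕ i + k))
  consecutive-card i = subst (λ a → P n -ₑ consecutiveEdges i ≅ Card n a) (tgt≡ i)
    (card-≅ (consecutiveEdges i) (trans (cong suc (src≡ i)) (sym (tgt≡ i))))

distinct₀₁ : ∀ {H k} (f : Fin (suc (suc k)) → Edge H) → Distinct {H} f → ¬ _≈ₑ_ {H} (f zero) (f (suc zero))
distinct₀₁ f d eq with d {zero} {suc zero} eq
... | ()

even-reconstructible : ∀ k → 0 < k → ReconstructibleFrom (P (suc k + suc k)) 2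
even-reconstructible k 0<k = consecutiveEdges 2 k bound , consecutive-distinct 2 k bound ,
  λ H f distinct φ →
    let ψ = λ i → ≅-trans (φ i) (consecutive-card 2 k bound i) in
    -- The card with parts `k + 1`, `k + 1` comes first; the one with parts `k + 2`, `k` serves both
    -- as second and as third card.
    reconstruct H (f (suc zero)) refl sum (s≤s z≤n) 0<k
      ≤-refl k≤ ≤-refl k≤ (ψ (suc zero)) (f zero) (f (suc zero)) (distinct₀₁ {H} f distinct)
      (ψ zero) (ψ (suc zero)) sum (s≤s z≤n) 0<k (λ ()) 1+n≢n (s≤s z≤n) (m<m+n (suc k) (s≤s z≤n))
  where
  sum : suc (suc k) + k ≡ suc k + suc k
  sum = sym (+-suc (suc k) k)
  bound : 2 + k < suc k + suc k
  bound = subst (2 + k <_) sum (m<m+n (2 + k) 0<k)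
  k≤ : k ≤ suc (suc k)
  k≤ = m≤n+m k 2

odd-reconstructible : ∀ k → 0 < k → ReconstructibleFrom (P (suc (suc k + suc k))) 3
odd-reconstructible k 0<k = consecutiveEdges 3 k bound , consecutive-distinct 3 k bound ,
  λ H f distinct φ →
    let ψ = λ i → ≅-trans (φ i) (consecutive-card 3 k bound i) in
    -- The first two cards both have parts `k + 1` and `k + 2`. The third, with parts `k + 3` and
    -- `k`, has no part of size `k + 1`, so it shows that the first deleted edge joins the two
    -- parts.
    reconstruct H (f (suc zero)) (+-suc (suc k) (suc k)) refl (s≤s z≤n) (s≤s z≤n)
      ≤-refl (n≤1+n _) (n≤1+n _) (m≤n+m (suc k) 2) (ψ (suc zero)) (f zero) (f (suc (suc zero)))
      (distinct₀₁ {H} f distinct)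
      (ψ zero) (ψ (suc (suc zero))) sum (s≤s z≤n) 0<k (λ ()) 1+n≢n (s≤s z≤n) (s≤s (m≤m+n (suc k) (suc k)))
  where
  sum : 3 + k + k ≡ suc (suc k + suc k)
  sum = cong suc (sym (+-suc (suc k) k))
  bound : 3 + k < suc (suc k + suc k)
  bound = subst (3 + k <_) sum (m<m+n (3 + k) 0<k)

-- The two parities

parity : ∀ n → ∃[ m ] (n ≡ m + m ⊎ n ≡ suc (m + m))
parity zero = zero , inj₁ refl
parity (suc n) with parity n
... | m , inj₁ refl = m , inj₂ refl
... | m , inj₂ refl = suc m , inj₁ (cong suc (sym (+-suc m m)))

2∣m+m : ∀ m → 2 ∣ m + m
2∣m+m m = divides m (trans (cong (m +_) (sym (+-identityʳ m))) (*-comm 2 m))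

theorem4p1 : (n : ℕ) → 5 ≤ n → (2 ∣ n → IsErn (P n) 2) × (¬ (2 ∣ n) → IsErn (P n) 3)
theorem4p1 n 5≤n = even , odd
  where
  0<n : 0 < n
  0<n = ≤-trans (s≤s z≤n) 5≤n
  even : 2 ∣ n → IsErn (P n) 2
  even (divides q eq) = positive q (trans eq (trans (*-comm q 2) (cong (q +_) (+-identityʳ q)))) , least
    where
    positive : ∀ m → n ≡ m + m → ReconstructibleFrom (P n) 2
    positive zero refl = contradiction 0<n λ ()
    positive (suc zero) refl = contradiction 5≤n λ { (s≤s (s≤s ())) }
    -- Here `n = 2(k + 1)`, and `k > 0` makes the smaller part of the unbalanced card nonempty.
    positive (suc k@(suc _)) refl = even-reconstructible k (s≤s z≤n)
    least : ∀ j → ReconstructibleFrom (P n) j → 2 ≤ j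
    least zero r = contradiction r (0-irreconstructible 0<n)
    least (suc zero) r = contradiction r (1-irreconstructible 5≤n)
    least (suc (suc j)) _ = s≤s (s≤s z≤n)
  odd : ¬ 2 ∣ n → IsErn (P n) 3
  odd 2∤n with parity n
  ... | m , inj₁ refl = contradiction (2∣m+m m) 2∤n
  ... | zero , inj₂ refl = contradiction 5≤n λ { (s≤s ()) }
  ... | suc zero , inj₂ refl = contradiction 5≤n λ { (s≤s (s≤s (s≤s ()))) }
  ... | suc k@(suc _) , inj₂ refl = odd-reconstructible k (s≤s z≤n) , least
    where
    least : ∀ j → ReconstructibleFrom (P n) j → 3 ≤ j
    least zero r = contradiction r (0-irreconstructible 0<n)
    least (suc zero) r = contradiction r (1-irreconstructible 5≤n)
    least (suc (suc zero)) r = contradiction r (2-irreconstructible {m = suc k} refl (s≤s (s≤s z≤n)))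
    least (suc (suc (suc j))) _ = s≤s (s≤s (s≤s z≤n))
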